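{- Let $r$ be a positive integer and let $P$ be an $r$-differential poset with rank sizes $p_n = |P_n|$ and rank gaps $\Delta p_n = p_n - p_{n-1}$. Then $\Delta p_n \geq 2r$ holds in each of the following cases: (i) $r=1$ and $n \geq 4$; (ii) $r=2$ and $n \geq 3$; (iii) $r > 2$ and $n \geq 2$.
   Context: Let $P$ be an $\mathbb{N}$-graded poset with $n$-th rank $P_n$ ($n \ge 0$), and let $\lessdot$ denote its covering relation. Let $\mathbb{Q}P_n$ be the $\mathbb{Q}$-vector space with basis $P_n$ (with $P_{ -1}=\emptyset$). The up and down operators $U_n : \mathbb{Q}P_n \to \mathbb{Q}P_{n+1}$ and $D_n : \mathbb{Q}P_n \to \mathbb{Q}P_{n-1}$ are the linear maps given for $x \in P_n$ by $U_n x = \sum_{y : x \lessdot y} y$ and $D_n x = \sum_{z : z \lessdot x} z$. For a positive integer $r$, an $r$-differential poset is a locally finite $\mathbb{N}$-graded poset $P$ with unique minimal element $\hat{0}$ (so $P_0=\{\hat 0\}$) such that the operators above are well defined (each element is covered by finitely many elements, so that all ranks are finite) and $D_{n+1}U_n - U_{n-1}D_n = r\cdot I$ on $\mathbb{Q}P_n$ for all $n \geq 0$. -}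

module Defs where

open import Level using (Level; _⊔_; suc)
open import Algebra.Properties.CommutativeMonoid.Sum using (sum)
open import Data.Bool.Base using (if_then_else_)
open import Data.Fin.Base using (Fin)
import Data.Fin.Properties as Fin
open import Data.Integer.Base as ℤ using (ℤ; +_)
open import Data.Nat.Base as ℕ using (ℕ)
import Data.Nat.Properties as ℕ
open import Data.Product.Base using (∃; _×_; _,_; proj₁; proj₂)
open import Data.Rational.Base as ℚ using (ℚ; 0ℚ; 1ℚ)
import Data.Rational.Properties as ℚ
open import Data.Vec.Functional using (Vector)
open import Function.Bundles using (Inverse)
open import Relation.Binary.Bundles using (Poset; Setoid)
import Relation.Binary.Construct.On as On
open import Relation.Binary.Definitions using (Decidable)
open import Relation.Binary.PropositionalEquality.Core using (_≡_)
open import Relation.Binary.PropositionalEquality.Properties using (setoid)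
import Relation.Binary.Properties.Poset as PosetProperties
open import Relation.Nullary.Decidable.Core using (yes; no; does; map′)
open import Relation.Nullary.Negation.Core using (¬_)
open import Relation.Unary using (Pred)

private
  variable
    a c ℓ ℓ₁ ℓ₂ : Level

record Finite (S : Setoid a ℓ) : Set (a ⊔ ℓ) where
  field
    card : ℕ
    enum : Inverse (setoid (Fin card)) S

  open Inverse enum public using (to; from; strictlyInverseˡ)

module Order (P : Poset c ℓ₁ ℓ₂) where
  open Poset P
  open PosetProperties P public using (_<_)
  open PosetProperties P using (<-respʳ-≈)

  infix 4 _⋖_

  _⋖_ : Carrier → Carrier → Set (c ⊔ ℓ₁ ⊔ ℓ₂)
  x ⋖ y = x < y × (∀ z → ¬ (x < z × z < y))

  Minimal : Carrier → Set (c ⊔ ℓ₁ ⊔ ℓ₂)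
  Minimal x = ∀ y → ¬ (y < x)

  Subset : Pred Carrier ℓ → Setoid (c ⊔ ℓ) ℓ₁
  Subset Q = On.setoid Eq.setoid (proj₁ {B = Q})

  ⋖-respʳ-≈ : ∀ {x y y′} → y ≈ y′ → x ⋖ y → x ⋖ y′
  ⋖-respʳ-≈ y≈y′ (x<y , none) =
    <-respʳ-≈ y≈y′ x<y ,
    λ z (x<z , z<y′) → none z (x<z , <-respʳ-≈ (Eq.sym y≈y′) z<y′)

-- A locally finite ℕ-graded poset with a unique minimal element in which every
-- element has finitely many upper covers.  The rank function is determined by
-- the order.  rank-finite follows from the other axioms; it is a field so that
-- the sizes of the ranks are at hand.
record GradedPoset c ℓ₁ ℓ₂ : Set (suc (c ⊔ ℓ₁ ⊔ ℓ₂)) where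
  field
    poset : Poset c ℓ₁ ℓ₂

  open Poset poset public
  open Order poset public

  field
    rank         : Carrier → ℕ
    rank-cong    : ∀ {x y} → x ≈ y → rank x ≡ rank y
    rank-mono    : ∀ {x y} → x < y → rank x ℕ.< rank y
    rank-cover   : ∀ {x y} → x ⋖ y → rank y ≡ ℕ.suc (rank x)
    rank-minimal : ∀ {x} → Minimal x → rank x ≡ 0

    0̂         : Carrier
    0̂-minimal : Minimal 0̂
    0̂-unique  : ∀ x → Minimal x → x ≈ 0̂

    interval-finite : ∀ {x y} → x ≤ y → Finite (Subset λ z → x ≤ z × z ≤ y)
    covers-finite   : ∀ x → Finite (Subset (x ⋖_))
    rank-finite     : ∀ n → Finite (Subset λ x → rank x ≡ n)

  p : ℕ → ℕ
  p n = Finite.card (rank-finite n)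

  -- p₋ n is pₙ₋₁, with P₋₁ = ∅.
  p₋ : ℕ → ℕ
  p₋ ℕ.zero    = 0
  p₋ (ℕ.suc n) = p n

  Δp : ℕ → ℤ
  Δp n = + p n ℤ.- + p₋ n

  element : ∀ n → Fin (p n) → Carrier
  element n i = proj₁ (Finite.to (rank-finite n) i)

  infix 4 _≈?_ _⋖?_

  _≈?_ : Decidable _≈_
  x ≈? y with rank x ℕ.≟ rank y
  ... | no  rx≢ry = no λ x≈y → rx≢ry (rank-cong x≈y)
  ... | yes rx≡ry = map′ sound complete (from x′ Fin.≟ from y′)
    where
    open Finite (rank-finite (rank y))
    open Inverse enum using (to-cong; from-cong)
    x′ y′ : ∃ λ z → rank z ≡ rank y
    x′ = x , rx≡ry
    y′ = y , _≡_.refl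
    sound : from x′ ≡ from y′ → x ≈ y
    sound eq = Eq.trans (Eq.sym (strictlyInverseˡ x′))
                        (Eq.trans (to-cong eq) (strictlyInverseˡ y′))
    complete : x ≈ y → from x′ ≡ from y′
    complete = from-cong

  _⋖?_ : Decidable _⋖_
  x ⋖? y = map′ sound complete (Fin.any? λ i → proj₁ (to i) ≈? y)
    where
    open Finite (covers-finite x)
    sound : (∃ λ i → proj₁ (to i) ≈ y) → x ⋖ y
    sound (i , eq) = ⋖-respʳ-≈ eq (proj₂ (to i))
    complete : x ⋖ y → ∃ λ i → proj₁ (to i) ≈ y
    complete x⋖y = from (y , x⋖y) , strictlyInverseˡ (y , x⋖y)

  -- ℚPₙ, each vector given by its coordinates in the basis Pₙ.
  ℚP : ℕ → Set
  ℚP n = Vector ℚ (p n)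

  ℚP₋ : ℕ → Set
  ℚP₋ n = Vector ℚ (p₋ n)

  -- The linear map sending the i-th basis vector to b i.
  extend : ∀ {k m} → (Fin k → Vector ℚ m) → Vector ℚ k → Vector ℚ m
  extend b v j = sum ℚ.+-0-commutativeMonoid λ i → v i ℚ.* b i j

  -- The coordinates of Σ_{y : x ⋖ y} y and of Σ_{z : z ⋖ x} z.
  upperCovers : ∀ n → Carrier → ℚP n
  upperCovers n x j = if does (x ⋖? element n j) then 1ℚ else 0ℚ

  lowerCovers : ∀ n → Carrier → ℚP n
  lowerCovers n x j = if does (element n j ⋖? x) then 1ℚ else 0ℚ

  U : ∀ n → ℚP n → ℚP (ℕ.suc n)
  U n = extend λ i → upperCovers (ℕ.suc n) (element n i)

  -- U₋ n is Uₙ₋₁, with U₋₁ the zero map out of ℚP₋₁ = 0.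
  U₋ : ∀ n → ℚP₋ n → ℚP n
  U₋ ℕ.zero    _ = λ _ → 0ℚ
  U₋ (ℕ.suc n)   = U n

  D : ∀ n → ℚP n → ℚP₋ n
  D ℕ.zero    _ = λ ()
  D (ℕ.suc n)   = extend λ i → lowerCovers n (element (ℕ.suc n) i)

record DifferentialPoset (r : ℕ) c ℓ₁ ℓ₂ : Set (suc (c ⊔ ℓ₁ ⊔ ℓ₂)) where
  field
    gradedPoset : GradedPoset c ℓ₁ ℓ₂

  open GradedPoset gradedPoset public

  field
    commutation : ∀ n (v : ℚP n) i →
      D (ℕ.suc n) (U n v) i ℚ.- U₋ n (D n v) i ≡ (+ r ℚ./ 1) ℚ.* v i

{-# OPTIONS --safe #-}

-- In rank 2 there are 2r elements, two above each atom, that cover only one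
-- element, and each of them starts a thread: an upward chain of such elements.
-- Let U v be a combination w = Σ tᵢ yᵢ of the tips of the 2r threads in rank n,
-- and let N = Σ tᵢ².  From Dᵏ U = U Dᵏ + k r Dᵏ⁻¹ the numbers
-- Cₖ = ⟨ Dᵏ⁺¹ w , Dᵏ v ⟩ satisfy Cₖ = |Dᵏ w|² - k r Cₖ₋₁, and |Dᵏ w|² = N as long
-- as Dᵏ w lies in rank at least 2, so that Cₖ = cₖ N with c₀ = 1 and
-- cₖ = 1 - k r cₖ₋₁.  In ranks 1 and 0 the norms satisfy |Dⁿ⁻¹ w|² ≤ 2 N and
-- |Dⁿ w|² ≤ r |Dⁿ⁻¹ w|², which gives 0 ≤ (n - 1) r cₙ₋₂ N ≤ 2 N.  In the cases of
-- the theorem (n - 1) r ≥ 3 and cₙ₋₂ ≠ 0, hence N = 0.  Thus the image of the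
-- injective map U meets the span of the 2r tips trivially.
--
-- Since the operators have integer matrices, it is enough to work over ℤ.

module Submission where

open import Defs

module IntegerMatrices where

  import Algebra.Properties.CommutativeMonoid.Sum as Sum
  open import Data.Bool.Base using (Bool; true; false; if_then_else_)
  open import Data.Fin.Base using (Fin; zero; suc; splitAt; join; _↑ˡ_; _↑ʳ_; punchIn; punchOut)
  open import Data.Fin.Properties as Fin
    using (¬∀⟶∃¬; splitAt⁻¹-↑ˡ; splitAt⁻¹-↑ʳ; join-splitAt; punchIn-punchOut)
  open import Data.Integer.Base using (ℤ; +_; -[1+_]; +≤+; 0ℤ; 1ℤ; -1ℤ; _+_; _*_; _-_; -_; _≤_; _<_; _⊖_)
  open import Data.Integer.Properties as ℤ hiding (suc-mono)
  open import Algebra.Properties.Semiring.Sum ℤ.+-*-semiring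
  open import Data.Integer.Tactic.RingSolver using (solve-∀)
  open import Data.Nat.Base as ℕ using (ℕ; zero; suc; z≤n; s≤s)
  import Data.Nat.Properties as ℕ
  open import Data.Product.Base using (∃; _×_; _,_; proj₁; proj₂)
  open import Data.Rational.Base as ℚ using (ℚ; 0ℚ; 1ℚ; toℚᵘ)
  import Data.Rational.Properties as ℚ
  open import Data.Rational.Unnormalised.Base as ℚᵘ using (mkℚᵘ; *≡*)
  import Data.Rational.Unnormalised.Properties as ℚᵘ
  open import Data.Sum.Base using (_⊎_; inj₁; inj₂; [_,_]′)
  open import Data.Vec.Functional using (Vector; transpose; take; drop; _++_; _∷_)
  open import Data.Vec.Functional.Properties using (lookup-++ˡ; lookup-++ʳ)
  open import Function.Base using (id; _∘_)
  open import Function.Definitions using (Injective)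
  open import Relation.Binary.PropositionalEquality hiding ([_])
  open import Relation.Nullary using (yes; no; does; contradiction)
  open Sum ℚ.+-0-commutativeMonoid using () renaming (sum to sumℚ; sum-cong-≗ to sumℚ-cong)

  private
    variable
      m n : ℕ

  -- Finite sums, the Kronecker delta and the inner product over ℤ.

  sum-zero : {f : Vector ℤ n} → (∀ i → f i ≡ 0ℤ) → sum f ≡ 0ℤ
  sum-zero {n} f≡0 = trans (sum-cong-≗ f≡0) (sum-replicate-zero n)

  sum-nonNeg : {f : Vector ℤ n} → (∀ i → 0ℤ ≤ f i) → 0ℤ ≤ sum f
  sum-nonNeg {zero}  0≤f = ≤-refl
  sum-nonNeg {suc n} 0≤f = +-mono-≤ (0≤f zero) (sum-nonNeg (0≤f ∘ suc))

  term≤sum : {f : Vector ℤ n} → (∀ i → 0ℤ ≤ f i) → ∀ i → f i ≤ sum f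
  term≤sum {suc n} {f} 0≤f i = begin
    f i                        ≡⟨ +-identityʳ (f i) ⟨
    f i + 0ℤ                   ≤⟨ +-monoʳ-≤ (f i) (sum-nonNeg (0≤f ∘ punchIn i)) ⟩
    f i + sum (f ∘ punchIn i)  ≡⟨ sum-remove f ⟨
    sum f                      ∎
    where open ≤-Reasoning

  sum-↑ : ∀ m {n} (f : Vector ℤ (m ℕ.+ n)) → sum f ≡ sum (take m f) + sum (drop m f)
  sum-↑ zero    f = sym (+-identityˡ _)
  sum-↑ (suc m) f = trans (cong (λ s → f zero + s) (sum-↑ m (f ∘ suc))) (sym (+-assoc (f zero) _ _))

  δ : Fin n → Fin n → ℤ
  δ zero    zero    = 1ℤ
  δ zero    (suc j) = 0ℤ
  δ (suc i) zero    = 0ℤ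
  δ (suc i) (suc j) = δ i j

  δ-refl : (i : Fin n) → δ i i ≡ 1ℤ
  δ-refl zero    = refl
  δ-refl (suc i) = δ-refl i

  δ-≢ : {i j : Fin n} → i ≢ j → δ i j ≡ 0ℤ
  δ-≢ {i = zero}  {zero}  i≢j = contradiction refl i≢j
  δ-≢ {i = zero}  {suc j} i≢j = refl
  δ-≢ {i = suc i} {zero}  i≢j = refl
  δ-≢ {i = suc i} {suc j} i≢j = δ-≢ (i≢j ∘ cong suc)

  δ≡1⇒≡ : (i j : Fin n) → δ i j ≡ 1ℤ → i ≡ j
  δ≡1⇒≡ zero    zero    _  = refl
  δ≡1⇒≡ (suc i) (suc j) eq = cong suc (δ≡1⇒≡ i j eq)

  δ-injective : {f : Fin m → Fin n} → Injective _≡_ _≡_ f → ∀ i j → δ (f i) (f j) ≡ δ j i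
  δ-injective {f = f} inj i j with i Fin.≟ j
  ... | yes refl = trans (δ-refl (f i)) (sym (δ-refl i))
  ... | no  i≢j  = trans (δ-≢ (i≢j ∘ inj)) (sym (δ-≢ (i≢j ∘ sym)))

  ⟨_,_⟩ : Vector ℤ n → Vector ℤ n → ℤ
  ⟨ u , v ⟩ = sum λ i → u i * v i

  ⟨⟩-congʳ : {u u′ : Vector ℤ n} → u ≗ u′ → ∀ v → ⟨ u , v ⟩ ≡ ⟨ u′ , v ⟩
  ⟨⟩-congʳ u≗u′ v = sum-cong-≗ λ i → cong (_* v i) (u≗u′ i)

  ⟨⟩-congˡ : (u : Vector ℤ n) {v v′ : Vector ℤ n} → v ≗ v′ → ⟨ u , v ⟩ ≡ ⟨ u , v′ ⟩
  ⟨⟩-congˡ u v≗v′ = sum-cong-≗ λ i → cong (λ x → u i * x) (v≗v′ i)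

  ⟨⟩-comm : (u v : Vector ℤ n) → ⟨ u , v ⟩ ≡ ⟨ v , u ⟩
  ⟨⟩-comm u v = sum-cong-≗ λ i → *-comm (u i) (v i)

  ⟨⟩-zeroˡ : {u : Vector ℤ n} → (∀ i → u i ≡ 0ℤ) → ∀ v → ⟨ u , v ⟩ ≡ 0ℤ
  ⟨⟩-zeroˡ u≡0 v = sum-zero λ i → cong (_* v i) (u≡0 i)

  ⟨⟩-+ˡ : (u v w : Vector ℤ n) → ⟨ (λ i → u i + v i) , w ⟩ ≡ ⟨ u , w ⟩ + ⟨ v , w ⟩
  ⟨⟩-+ˡ u v w = trans (sum-cong-≗ λ i → *-distribʳ-+ (w i) (u i) (v i))
                      (∑-distrib-+ (λ i → u i * w i) λ i → v i * w i)

  ⟨⟩-*ˡ : ∀ a (v w : Vector ℤ n) → ⟨ (λ i → a * v i) , w ⟩ ≡ a * ⟨ v , w ⟩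
  ⟨⟩-*ˡ a v w =
    trans (sum-cong-≗ λ i → *-assoc a (v i) (w i)) (sym (*-distribˡ-sum a λ i → v i * w i))

  ⟨⟩-linearˡ : ∀ a (u v w : Vector ℤ n) →
               ⟨ (λ i → u i + a * v i) , w ⟩ ≡ ⟨ u , w ⟩ + a * ⟨ v , w ⟩
  ⟨⟩-linearˡ a u v w = trans (⟨⟩-+ˡ u (λ i → a * v i) w) (cong (λ s → ⟨ u , w ⟩ + s) (⟨⟩-*ˡ a v w))

  ⟨⟩-square : ∀ a (u v : Vector ℤ n) → let w = λ i → u i + a * v i in
              ⟨ w , w ⟩ ≡ ⟨ u , u ⟩ + + 2 * a * ⟨ u , v ⟩ + a * a * ⟨ v , v ⟩
  ⟨⟩-square a u v = begin
    ⟨ w , w ⟩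
      ≡⟨ ⟨⟩-linearˡ a u v w ⟩
    ⟨ u , w ⟩ + a * ⟨ v , w ⟩
      ≡⟨ cong₂ (λ x y → x + a * y) (expand u) (expand v) ⟩
    ⟨ u , u ⟩ + a * ⟨ v , u ⟩ + a * (⟨ u , v ⟩ + a * ⟨ v , v ⟩)
      ≡⟨ cong (λ x → ⟨ u , u ⟩ + a * x + a * (⟨ u , v ⟩ + a * ⟨ v , v ⟩)) (⟨⟩-comm v u) ⟩
    ⟨ u , u ⟩ + a * ⟨ u , v ⟩ + a * (⟨ u , v ⟩ + a * ⟨ v , v ⟩)
      ≡⟨ collect a ⟨ u , u ⟩ ⟨ u , v ⟩ ⟨ v , v ⟩ ⟩
    ⟨ u , u ⟩ + + 2 * a * ⟨ u , v ⟩ + a * a * ⟨ v , v ⟩ ∎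
    where
    open ≡-Reasoning
    w = λ i → u i + a * v i
    expand : ∀ x → ⟨ x , w ⟩ ≡ ⟨ u , x ⟩ + a * ⟨ v , x ⟩
    expand x = trans (⟨⟩-comm x w) (⟨⟩-linearˡ a u v x)
    collect : ∀ a x y z → x + a * y + a * (y + a * z) ≡ x + + 2 * a * y + a * a * z
    collect = solve-∀

  ⟨⟩-δ : (v : Vector ℤ n) (x : Fin n) → ⟨ v , δ x ⟩ ≡ v x
  ⟨⟩-δ v zero = trans
    (cong₂ _+_ (*-identityʳ (v zero)) (sum-zero λ i → *-zeroʳ (v (suc i))))
    (+-identityʳ (v zero))
  ⟨⟩-δ v (suc x) = trans
    (cong₂ _+_ (*-zeroʳ (v zero)) (⟨⟩-δ (v ∘ suc) x))
    (+-identityˡ (v (suc x)))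

  ⟨⟩-take-drop : ∀ m {n} (u v : Vector ℤ (m ℕ.+ n)) →
                 ⟨ u , v ⟩ ≡ ⟨ take m u , take m v ⟩ + ⟨ drop m u , drop m v ⟩
  ⟨⟩-take-drop m u v = sum-↑ m λ i → u i * v i

  ⟨⟩-++ : ∀ m {n} (x : Vector ℤ (m ℕ.+ n)) (a : Vector ℤ m) (b : Vector ℤ n) →
          ⟨ x , a ++ b ⟩ ≡ ⟨ take m x , a ⟩ + ⟨ drop m x , b ⟩
  ⟨⟩-++ m x a b = trans (⟨⟩-take-drop m x (a ++ b)) (cong₂ _+_
    (⟨⟩-congˡ (take m x) (lookup-++ˡ a b)) (⟨⟩-congˡ (drop m x) (lookup-++ʳ a b)))

  0≤i*i : ∀ i → 0ℤ ≤ i * i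
  0≤i*i (+ n)    = subst (0ℤ ≤_) (pos-* n n) (+≤+ z≤n)
  0≤i*i -[1+ n ] = +≤+ z≤n

  0≤⟨v,v⟩ : (v : Vector ℤ n) → 0ℤ ≤ ⟨ v , v ⟩
  0≤⟨v,v⟩ v = sum-nonNeg λ i → 0≤i*i (v i)

  ⟨v,v⟩≡0⇒v≡0 : (v : Vector ℤ n) → ⟨ v , v ⟩ ≡ 0ℤ → ∀ i → v i ≡ 0ℤ
  ⟨v,v⟩≡0⇒v≡0 v ⟨v,v⟩≡0 i = [ id , id ]′ (i*j≡0⇒i≡0∨j≡0 (v i)
    (≤-antisym (subst (_ ≤_) ⟨v,v⟩≡0 (term≤sum (λ j → 0≤i*i (v j)) i)) (0≤i*i (v i))))

  -- Integer matrices: adjoints, incidence matrices and kernels.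

  Matrix : ℕ → ℕ → Set
  Matrix m n = Vector (Vector ℤ n) m

  infixr 8 _·_

  _·_ : Matrix m n → Vector ℤ n → Vector ℤ m
  (A · v) i = ⟨ v , A i ⟩

  ·-cong : (A : Matrix m n) {u v : Vector ℤ n} → u ≗ v → A · u ≗ A · v
  ·-cong A u≗v i = ⟨⟩-congʳ u≗v (A i)

  ·-linear : (A : Matrix m n) → ∀ a u v → A · (λ j → u j + a * v j) ≗ λ i → (A · u) i + a * (A · v) i
  ·-linear A a u v i = ⟨⟩-linearˡ a u v (A i)

  adjoint : (A : Matrix m n) → ∀ v w → ⟨ A · v , w ⟩ ≡ ⟨ v , transpose A · w ⟩
  adjoint A v w = begin
    sum (λ i → ⟨ v , A i ⟩ * w i)
      ≡⟨ sum-cong-≗ (λ i → *-distribʳ-sum (w i) λ j → v j * A i j) ⟩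
    sum (λ i → sum λ j → v j * A i j * w i)
      ≡⟨ ∑-comm (λ i j → v j * A i j * w i) ⟩
    sum (λ j → sum λ i → v j * A i j * w i)
      ≡⟨ sum-cong-≗ (λ j → sum-cong-≗ λ i → rearrange (v j) (A i j) (w i)) ⟩
    sum (λ j → sum λ i → v j * (w i * A i j))
      ≡⟨ sum-cong-≗ (λ j → sym (*-distribˡ-sum (v j) λ i → w i * A i j)) ⟩
    sum (λ j → v j * ⟨ w , (λ i → A i j) ⟩) ∎
    where
    open ≡-Reasoning
    rearrange : ∀ a b c → a * b * c ≡ a * (c * b)
    rearrange = solve-∀

  -- Column `i` is the basis vector at `f i`, so `incidence f · t` is the combination of the
  -- elements `f i` with coefficients `t i`.
  incidence : (Fin m → Fin n) → Matrix n m
  incidence f z i = δ (f i) z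

  incidenceᵀ : (f : Fin m → Fin n) → ∀ v → transpose (incidence f) · v ≗ v ∘ f
  incidenceᵀ f v i = ⟨⟩-δ v (f i)

  -- For injective `f` the columns of the incidence matrix are orthonormal.
  incidence-norm : {f : Fin m → Fin n} → Injective _≡_ _≡_ f → ∀ t →
                   ⟨ incidence f · t , incidence f · t ⟩ ≡ ⟨ t , t ⟩
  incidence-norm {f = f} inj t = trans (adjoint (incidence f) t (incidence f · t)) (⟨⟩-congˡ t λ j → begin
    (transpose (incidence f) · (incidence f · t)) j  ≡⟨ incidenceᵀ f (incidence f · t) j ⟩
    ⟨ t , (λ i → δ (f i) (f j)) ⟩                     ≡⟨ ⟨⟩-congˡ t (λ i → δ-injective inj i j) ⟩
    ⟨ t , δ j ⟩                                       ≡⟨ ⟨⟩-δ t j ⟩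
    t j                                              ∎)
    where open ≡-Reasoning

  -- Fraction-free elimination with a pivot in the first column.
  solution : (A : Matrix m n) → m ℕ.< n → ∃ λ x → (∃ λ j → x j ≢ 0ℤ) × ∀ i → (A · x) i ≡ 0ℤ
  solution {zero}  {suc n} A _ = (λ _ → 1ℤ) , (zero , λ ()) , λ ()
  solution {suc m} {suc n} A (s≤s m<n) with Fin.all? (λ i → A i zero ℤ.≟ 0ℤ)
  ... | yes A₀≡0 = δ zero , (zero , λ ()) , λ i →
    trans (⟨⟩-comm (δ zero) (A i)) (trans (⟨⟩-δ (A i) zero) (A₀≡0 i))
  ... | no ¬A₀≡0 with ¬∀⟶∃¬ (suc m) _ (λ i → A i zero ℤ.≟ 0ℤ) ¬A₀≡0
  ... | i , a≢0 with solution B m<n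
    where
    a = A i zero
    B : Matrix m n
    B k j = a * A (punchIn i k) (suc j) + (- A (punchIn i k) zero) * A i (suc j)
  ... | y , (j , yj≢0) , By≡0 = x , (suc j , xj≢0) , Ax≡0
    where
    a = A i zero
    S = ⟨ y , A i ∘ suc ⟩
    x = (- S) ∷ λ k → a * y k
    xj≢0 : a * y j ≢ 0ℤ
    xj≢0 eq = [ a≢0 , yj≢0 ]′ (i*j≡0⇒i≡0∨j≡0 a eq)
    expand : ∀ k → (A · x) k ≡ (- S) * A k zero + a * ⟨ y , A k ∘ suc ⟩
    expand k = cong (λ s → (- S) * A k zero + s) (⟨⟩-*ˡ a y (A k ∘ suc))
    Ax≡0 : ∀ k → (A · x) k ≡ 0ℤ
    Ax≡0 k with i Fin.≟ k
    ... | yes refl = trans (expand i) (cancel S a)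
      where
      cancel : ∀ s a → (- s) * a + a * s ≡ 0ℤ
      cancel = solve-∀
    ... | no i≢k = subst (λ l → (A · x) l ≡ 0ℤ) (punchIn-punchOut i≢k) (begin
      (A · x) l
        ≡⟨ expand l ⟩
      (- S) * A l zero + a * ⟨ y , A l ∘ suc ⟩
        ≡⟨ regroup S (A l zero) (a * ⟨ y , A l ∘ suc ⟩) ⟩
      a * ⟨ y , A l ∘ suc ⟩ + (- A l zero) * S
        ≡⟨ cong₂ (λ u v → a * u + (- A l zero) * v) (⟨⟩-comm y (A l ∘ suc)) (⟨⟩-comm y (A i ∘ suc)) ⟩
      a * ⟨ A l ∘ suc , y ⟩ + (- A l zero) * ⟨ A i ∘ suc , y ⟩
        ≡⟨ cong (_+ (- A l zero) * ⟨ A i ∘ suc , y ⟩) (⟨⟩-*ˡ a (A l ∘ suc) y) ⟨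
      ⟨ (λ j → a * A l (suc j)) , y ⟩ + (- A l zero) * ⟨ A i ∘ suc , y ⟩
        ≡⟨ ⟨⟩-linearˡ (- A l zero) (λ j → a * A l (suc j)) (A i ∘ suc) y ⟨
      ⟨ (λ j → a * A l (suc j) + (- A l zero) * A i (suc j)) , y ⟩
        ≡⟨ ⟨⟩-comm (λ j → a * A l (suc j) + (- A l zero) * A i (suc j)) y ⟩
      ⟨ y , (λ j → a * A l (suc j) + (- A l zero) * A i (suc j)) ⟩
        ≡⟨ By≡0 (punchOut i≢k) ⟩
      0ℤ                                               ∎)
      where
      open ≡-Reasoning
      l = punchIn i (punchOut i≢k)
      regroup : ∀ s b c → (- s) * b + c ≡ c + (- b) * s
      regroup = solve-∀

  -- A homogeneous system with more unknowns than equations has a non-zero integer solution. This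
  -- takes the place of a comparison of dimensions over ℚ.
  trivial-kernel⇒≤ : (A : Matrix m n) → (∀ x → (∀ i → (A · x) i ≡ 0ℤ) → ∀ j → x j ≡ 0ℤ) → n ℕ.≤ m
  trivial-kernel⇒≤ A trivial = ℕ.≮⇒≥ λ m<n →
    let x , (j , xj≢0) , Ax≡0 = solution A m<n in xj≢0 (trivial x Ax≡0 j)

  -- The norm of a sum, joined injections and counting by sums.

  norm-+-≤ : (u v w : Vector ℤ n) → w ≗ (λ i → u i + v i) →
             ⟨ w , w ⟩ ≤ + 2 * (⟨ u , u ⟩ + ⟨ v , v ⟩)
  -- By the parallelogram law the difference of the two sides is |u - v|².
  norm-+-≤ u v w w≗u+v = 0≤i-j⇒j≤i (≤-trans (0≤⟨v,v⟩ (λ i → u i + -1ℤ * v i)) (≤-reflexive (begin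
    ⟨ (λ i → u i + -1ℤ * v i) , (λ i → u i + -1ℤ * v i) ⟩
      ≡⟨ ⟨⟩-square -1ℤ u v ⟩
    ⟨ u , u ⟩ + + 2 * -1ℤ * ⟨ u , v ⟩ + -1ℤ * -1ℤ * ⟨ v , v ⟩
      ≡⟨ simplify ⟨ u , u ⟩ ⟨ u , v ⟩ ⟨ v , v ⟩ ⟩
    + 2 * (⟨ u , u ⟩ + ⟨ v , v ⟩) - (⟨ u , u ⟩ + + 2 * 1ℤ * ⟨ u , v ⟩ + 1ℤ * 1ℤ * ⟨ v , v ⟩)
      ≡⟨ cong (λ s → + 2 * (⟨ u , u ⟩ + ⟨ v , v ⟩) - s) (sym ⟨w,w⟩) ⟩
    + 2 * (⟨ u , u ⟩ + ⟨ v , v ⟩) - ⟨ w , w ⟩ ∎)))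
    where
    open ≡-Reasoning
    w≗ : w ≗ λ i → u i + 1ℤ * v i
    w≗ i = trans (w≗u+v i) (cong (λ x → u i + x) (sym (*-identityˡ (v i))))
    simplify : ∀ x y z → x + + 2 * -1ℤ * y + -1ℤ * -1ℤ * z ≡
                         + 2 * (x + z) - (x + + 2 * 1ℤ * y + 1ℤ * 1ℤ * z)
    simplify = solve-∀
    ⟨w,w⟩ : ⟨ w , w ⟩ ≡ ⟨ u , u ⟩ + + 2 * 1ℤ * ⟨ u , v ⟩ + 1ℤ * 1ℤ * ⟨ v , v ⟩
    ⟨w,w⟩ = trans (trans (⟨⟩-congʳ w≗ w) (⟨⟩-congˡ (λ i → u i + 1ℤ * v i) w≗)) (⟨⟩-square 1ℤ u v)

  -- The map `φ` is there because the two families to be joined consist of threads, of which only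
  -- the tops are compared.
  ∘-++-injective : ∀ {a b} {A : Set a} {B : Set b} (φ : A → B) {f : Vector A m} {g : Vector A n} →
                   Injective _≡_ _≡_ (φ ∘ f) → Injective _≡_ _≡_ (φ ∘ g) →
                   (∀ i j → φ (f i) ≢ φ (g j)) → Injective _≡_ _≡_ (φ ∘ (f ++ g))
  ∘-++-injective {m = m} φ f-inj g-inj disjoint {i} {j} eq with splitAt m i in eqᵢ | splitAt m j in eqⱼ
  ... | inj₁ i′ | inj₁ j′ = trans (sym (splitAt⁻¹-↑ˡ eqᵢ)) (trans (cong (_↑ˡ _) (f-inj eq)) (splitAt⁻¹-↑ˡ eqⱼ))
  ... | inj₁ i′ | inj₂ j′ = contradiction eq (disjoint i′ j′)
  ... | inj₂ i′ | inj₁ j′ = contradiction (sym eq) (disjoint j′ i′)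
  ... | inj₂ i′ | inj₂ j′ = trans (sym (splitAt⁻¹-↑ʳ eqᵢ)) (trans (cong (m ↑ʳ_) (g-inj eq)) (splitAt⁻¹-↑ʳ eqⱼ))

  -- Each term contributes at most 1, so a sum of at least k has at least k positive terms. The
  -- recursion drops the first term: the target falls by one if that term is positive, and otherwise
  -- the remaining sum is no smaller.
  positive-terms : (f : Vector ℤ n) → (∀ i → f i ≤ 1ℤ) → ∀ k → + k ≤ sum f →
                   ∃ λ (g : Fin k → Fin n) → Injective _≡_ _≡_ g × ∀ j → 0ℤ < f (g j)
  positive-terms {n}     f f≤1 zero    _ = (λ ()) , (λ { {()} }) , λ ()
  positive-terms {zero}  f f≤1 (suc k) (+≤+ ())
  positive-terms {suc n} f f≤1 (suc k) k<∑ with 0ℤ <? f zero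
  ... | yes 0<f₀ = g , g-injective , positive
    where
    k≤∑ : + k ≤ sum (f ∘ suc)
    k≤∑ = subst₂ _≤_ (cancel (+ k)) (cancel (sum (f ∘ suc)))
      (+-monoʳ-≤ -1ℤ (≤-trans k<∑ (+-monoˡ-≤ (sum (f ∘ suc)) (f≤1 zero))))
      where
      cancel : ∀ a → -1ℤ + (1ℤ + a) ≡ a
      cancel = solve-∀
    rec = positive-terms (f ∘ suc) (f≤1 ∘ suc) k k≤∑
    g : Fin (suc k) → Fin (suc n)
    g = zero ∷ (suc ∘ proj₁ rec)
    g-injective : Injective _≡_ _≡_ g
    g-injective {zero}  {zero}  _  = refl
    g-injective {suc i} {suc j} eq = cong suc (proj₁ (proj₂ rec) (Fin.suc-injective eq))
    positive : ∀ j → 0ℤ < f (g j)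
    positive zero    = 0<f₀
    positive (suc j) = proj₂ (proj₂ rec) j
  ... | no 0≮f₀ =
    let k<∑′ = ≤-trans k<∑ (subst (sum f ≤_) (+-identityˡ (sum (f ∘ suc)))
                   (+-monoˡ-≤ (sum (f ∘ suc)) (≮⇒≥ 0≮f₀)))
        g , inj , positive = positive-terms (f ∘ suc) (f≤1 ∘ suc) (suc k) k<∑′
    in suc ∘ g , inj ∘ Fin.suc-injective , positive

  -- The terms other than the `i`-th are non-negative with sum at most 0. Applied to a column of
  -- `cover`, this recognises an element with a single lower cover.
  sum≤1⇒δ : (f : Vector ℤ n) → (∀ j → 0ℤ ≤ f j) → ∀ i → f i ≡ 1ℤ → sum f ≤ 1ℤ → f ≗ δ i
  sum≤1⇒δ {suc n} f 0≤f i fi≡1 ∑≤1 j with i Fin.≟ j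
  ... | yes refl = trans fi≡1 (sym (δ-refl i))
  ... | no i≢j = trans (≤-antisym fj≤0 (0≤f j)) (sym (δ-≢ i≢j))
    where
    open ≤-Reasoning
    rest = sum (f ∘ punchIn i)
    cancel : ∀ a → a ≡ -1ℤ + (1ℤ + a)
    cancel = solve-∀
    fj≤0 : f j ≤ 0ℤ
    fj≤0 = begin
      f j                           ≡⟨ cong f (punchIn-punchOut i≢j) ⟨
      f (punchIn i (punchOut i≢j))  ≤⟨ term≤sum (0≤f ∘ punchIn i) (punchOut i≢j) ⟩
      rest                          ≡⟨ cancel rest ⟩
      -1ℤ + (1ℤ + rest)             ≡⟨ cong (λ a → -1ℤ + (a + rest)) fi≡1 ⟨
      -1ℤ + (f i + rest)            ≡⟨ cong (λ s → -1ℤ + s) (sum-remove f) ⟨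
      -1ℤ + sum f                   ≤⟨ +-monoʳ-≤ -1ℤ ∑≤1 ⟩
      0ℤ                            ∎

  -- The covering relation as 0/1 matrices, and the numbers of covers.

  record CoverMatrices (r : ℕ) : Set where
    field
      p      : ℕ → ℕ
      cover  : ∀ n → Matrix (p n) (p (suc n))
      0∨1    : ∀ n x z → cover n x z ≡ 0ℤ ⊎ cover n x z ≡ 1ℤ
      origin : Fin (p 0)

    -- `D n` starts in rank n + 1, so it is Dₙ₊₁ in the usual numbering. Rank 0 has nothing below
    -- it, hence its commutation relation `DU₀` is separate and has no UD term.
    D : ∀ n → Vector ℤ (p (suc n)) → Vector ℤ (p n)
    D n v = cover n · v

    U : ∀ n → Vector ℤ (p n) → Vector ℤ (p (suc n))
    U n v = transpose (cover n) · v

    field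
      DU₀ : ∀ v x → D 0 (U 0 v) x ≡ + r * v x
      DU  : ∀ n v x → D (suc n) (U (suc n) v) x ≡ U n (D n v) x + + r * v x

    cover-nonNeg : ∀ n x z → 0ℤ ≤ cover n x z
    cover-nonNeg n x z with 0∨1 n x z
    ... | inj₁ eq = ≤-reflexive (sym eq)
    ... | inj₂ eq = subst (0ℤ ≤_) (sym eq) (+≤+ z≤n)

    cover-idem : ∀ n x z → cover n x z * cover n x z ≡ cover n x z
    cover-idem n x z with 0∨1 n x z
    ... | inj₁ eq rewrite eq = refl
    ... | inj₂ eq rewrite eq = refl

    U-δ : ∀ n y x → U n (δ y) x ≡ cover n y x
    U-δ n y x = trans (⟨⟩-comm (δ y) λ w → cover n w x) (⟨⟩-δ (λ w → cover n w x) y)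

    D-δ : ∀ n x y → D n (δ x) y ≡ cover n y x
    D-δ n x y = trans (⟨⟩-comm (δ x) (cover n y)) (⟨⟩-δ (cover n y) x)

    𝟙 : ∀ {n} → Vector ℤ n
    𝟙 _ = 1ℤ

    -- On the all-ones vector the down operator counts upper covers, and the up operator counts
    -- lower covers.
    ups : ∀ n → Fin (p n) → ℤ
    ups n = D n 𝟙

    downs : ∀ n → Fin (p (suc n)) → ℤ
    downs n = U n 𝟙

    OnlyCovers : ∀ n → Fin (p (suc n)) → Fin (p n) → Set
    OnlyCovers n x y = ∀ w → cover n w x ≡ δ y w

    -- Entries 0 and 1 equal their squares, so the number of upper covers is a diagonal entry of DU,
    -- which the commutation relation evaluates.
    ups-DU : ∀ n x → ups n x ≡ D n (U n (δ x)) x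
    ups-DU n x = begin
      ⟨ 𝟙 , cover n x ⟩          ≡⟨ sum-cong-≗ (λ z → trans (*-identityˡ _) (sym (cover-idem n x z))) ⟩
      ⟨ cover n x , cover n x ⟩  ≡⟨ ⟨⟩-congʳ (U-δ n x) (cover n x) ⟨
      D n (U n (δ x)) x          ∎
      where open ≡-Reasoning

    ups₀ : ∀ x → ups 0 x ≡ + r
    ups₀ x = trans (ups-DU 0 x) (trans (DU₀ (δ x) x)
      (trans (cong (λ a → + r * a) (δ-refl x)) (*-identityʳ (+ r))))

    U-OnlyCovers : ∀ {n x} y → OnlyCovers n x y → ∀ v → U n v x ≡ v y
    U-OnlyCovers y x▷y v = trans (⟨⟩-congˡ v x▷y) (⟨⟩-δ v y)

    -- On the diagonal, DU = UD + r says that an element has r more upper covers than lower covers;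
    -- here there is one lower cover.
    ups₊ : ∀ {n x} y → OnlyCovers n x y → ups (suc n) x ≡ 1ℤ + + r
    ups₊ {n} {x} y x▷y = begin
      ups (suc n) x                      ≡⟨ ups-DU (suc n) x ⟩
      D (suc n) (U (suc n) (δ x)) x      ≡⟨ DU n (δ x) x ⟩
      U n (D n (δ x)) x + + r * δ x x
        ≡⟨ cong₂ _+_ (U-OnlyCovers y x▷y (D n (δ x))) (cong (λ a → + r * a) (δ-refl x)) ⟩
      D n (δ x) y + + r * 1ℤ
        ≡⟨ cong₂ _+_ (trans (D-δ n x y) (trans (x▷y y) (δ-refl y))) (*-identityʳ (+ r)) ⟩
      1ℤ + + r                           ∎
      where open ≡-Reasoning

    surplus : ∀ n → Fin (p n) → ℤ
    surplus n x = + 2 * ups n x + -1ℤ * D n (downs n) x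

    -- surplus n x is the sum of 2 - downs z over the covers z of x.  Each term
    -- is at most 1, and it is positive only if z covers nothing but x.
    children : ∀ n x k → + k ≤ surplus n x →
               ∃ λ (g : Fin k → Fin (p (suc n))) → Injective _≡_ _≡_ g × ∀ i → OnlyCovers n (g i) x
    children n x k k≤surplus =
      let g , inj , positive = positive-terms f f≤1 k (≤-trans k≤surplus (≤-reflexive (sym ∑f)))
      in g , inj , λ i → only (g i) (positive i)
      where
      2-downs : Vector ℤ (p (suc n))
      2-downs z = + 2 * 𝟙 z + -1ℤ * downs n z

      f : Vector ℤ (p (suc n))
      f z = 2-downs z * cover n x z

      ∑f : sum f ≡ surplus n x
      ∑f = trans (⟨⟩-linearˡ -1ℤ (λ z → + 2 * 𝟙 z) (downs n) (cover n x))
                 (cong (_+ -1ℤ * D n (downs n) x) (⟨⟩-*ˡ (+ 2) 𝟙 (cover n x)))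

      downs-sum : ∀ z → downs n z ≡ sum λ w → cover n w z
      downs-sum z = sum-cong-≗ λ w → *-identityˡ (cover n w z)

      cover≤downs : ∀ z → cover n x z ≤ downs n z
      cover≤downs z = ≤-trans (term≤sum (λ w → cover-nonNeg n w z) x) (≤-reflexive (sym (downs-sum z)))

      f≤1 : ∀ z → f z ≤ 1ℤ
      f≤1 z with 0∨1 n x z
      ... | inj₁ eq = subst (λ a → 2-downs z * a ≤ 1ℤ) (sym eq)
                        (subst (_≤ 1ℤ) (sym (*-zeroʳ (2-downs z))) (+≤+ z≤n))
      ... | inj₂ eq = subst (λ a → 2-downs z * a ≤ 1ℤ) (sym eq) (begin
        2-downs z * 1ℤ
          ≡⟨ *-identityʳ (2-downs z) ⟩
        + 2 + -1ℤ * downs n z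
          ≤⟨ +-monoʳ-≤ (+ 2) (*-monoˡ-≤-nonPos -1ℤ (subst (_≤ downs n z) eq (cover≤downs z))) ⟩
        1ℤ ∎)
        where open ≤-Reasoning

      only : ∀ z → 0ℤ < f z → OnlyCovers n z x
      only z 0<f with 0∨1 n x z
      ... | inj₁ eq = contradiction
        (sym (trans (cong (λ a → 2-downs z * a) eq) (*-zeroʳ (2-downs z)))) (<⇒≢ 0<f)
      ... | inj₂ eq = sum≤1⇒δ (λ w → cover n w z) (λ w → cover-nonNeg n w z) x eq (begin
        sum (λ w → cover n w z)  ≡⟨ downs-sum z ⟨
        downs n z                ≡⟨ recover (downs n z) ⟩
        + 2 + -1ℤ * (+ 2 + -1ℤ * downs n z)
          ≤⟨ +-monoʳ-≤ (+ 2) (*-monoˡ-≤-nonPos -1ℤ (i<j⇒suc[i]≤j 0<2-downs)) ⟩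
        1ℤ                       ∎)
        where
        open ≤-Reasoning
        recover : ∀ d → d ≡ + 2 + -1ℤ * (+ 2 + -1ℤ * d)
        recover = solve-∀
        0<2-downs : 0ℤ < 2-downs z
        0<2-downs = subst (0ℤ <_) (trans (cong (λ a → 2-downs z * a) eq) (*-identityʳ (2-downs z))) 0<f

    surplus₀ : ∀ x → surplus 0 x ≡ + r
    surplus₀ x = trans (cong₂ (λ a b → + 2 * a + -1ℤ * b) (ups₀ x) (DU₀ 𝟙 x)) (simplify (+ r))
      where
      simplify : ∀ r → + 2 * r + -1ℤ * (r * 1ℤ) ≡ r
      simplify = solve-∀

    -- The subtracted term is DU applied to 𝟙, that is, UD applied to 𝟙 plus r. At `x` the outer U
    -- reads off the value at `y` alone, which is `ups n y`.
    surplus₊ : ∀ {n x} y → OnlyCovers n x y → surplus (suc n) x ≡ + 2 + + r + -1ℤ * ups n y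
    surplus₊ {n} {x} y x▷y = trans
      (cong₂ (λ a b → + 2 * a + -1ℤ * b) (ups₊ y x▷y)
        (trans (DU n 𝟙 x) (cong (_+ + r * 1ℤ) (U-OnlyCovers y x▷y (D n 𝟙)))))
      (simplify (+ r) (ups n y))
      where
      simplify : ∀ r u → + 2 * (1ℤ + r) + -1ℤ * (u + r * 1ℤ) ≡ + 2 + r + -1ℤ * u
      simplify = solve-∀

    -- Links of threads and their continuation.

    record Thread (n : ℕ) : Set where
      field
        top      : Fin (p (suc n))
        below    : Fin (p n)
        covers   : OnlyCovers n top below
        -- By `surplus₊` this gives `top` a surplus of at least 1, so the thread can be continued.
        ups-≤    : ups n below ≤ 1ℤ + + r

    open Thread

    -- The old `top` becomes the new `below`. As it covers one element only, it has exactly 1 + r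
    -- upper covers, so the bound persists.
    extension : ∀ {n} → Thread n → Thread (suc n)
    extension {n} t = record
      { top    = proj₁ child zero
      ; below  = top t
      ; covers = proj₂ (proj₂ child) zero
      ; ups-≤  = ≤-reflexive (ups₊ (below t) (covers t))
      }
      where
      open ≤-Reasoning
      simplify : ∀ r → 1ℤ ≡ + 2 + r + -1ℤ * (1ℤ + r)
      simplify = solve-∀
      1≤surplus : 1ℤ ≤ surplus (suc n) (top t)
      1≤surplus = begin
        1ℤ                                     ≡⟨ simplify (+ r) ⟩
        + 2 + + r + -1ℤ * (1ℤ + + r)           ≤⟨ +-monoʳ-≤ (+ 2 + + r) (*-monoˡ-≤-nonPos -1ℤ (ups-≤ t)) ⟩
        + 2 + + r + -1ℤ * ups n (below t)      ≡⟨ surplus₊ (below t) (covers t) ⟨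
        surplus (suc n) (top t)                ∎
      child = children (suc n) (top t) 1 1≤surplus

    OnlyCovers-unique : ∀ {n x} y y′ → OnlyCovers n x y → OnlyCovers n x y′ → y ≡ y′
    OnlyCovers-unique y y′ x▷y x▷y′ =
      δ≡1⇒≡ y y′ (trans (sym (x▷y y′)) (trans (x▷y′ y′) (δ-refl y′)))

    -- D sends an element with a single lower cover to that cover, so a combination of tips moves
    -- down its threads with unchanged coefficients.
    D-incidence : ∀ {n} (f : Fin m → Fin (p (suc n))) (g : Fin m → Fin (p n)) →
                  (∀ i → OnlyCovers n (f i) (g i)) →
                  ∀ t → D n (incidence f · t) ≗ incidence g · t
    D-incidence {n = n} f g f▷g t x = begin
      ⟨ incidence f · t , cover n x ⟩                ≡⟨ adjoint (incidence f) t (cover n x) ⟩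
      ⟨ t , transpose (incidence f) · cover n x ⟩    ≡⟨ ⟨⟩-congˡ t (λ i → trans (incidenceᵀ f (cover n x) i) (f▷g i x)) ⟩
      ⟨ t , (λ i → δ (g i) x) ⟩                      ∎
      where open ≡-Reasoning

    -- Linearity, adjointness and norms of the up and down operators.

    D-cong : ∀ n {u v} → u ≗ v → D n u ≗ D n v
    D-cong n = ·-cong (cover n)

    D-linear : ∀ n a u v x → D n (λ j → u j + a * v j) x ≡ D n u x + a * D n v x
    D-linear n = ·-linear (cover n)

    D-adjoint : ∀ n v w → ⟨ D n v , w ⟩ ≡ ⟨ v , U n w ⟩
    D-adjoint n = adjoint (cover n)

    U-adjoint : ∀ n v w → ⟨ U n v , w ⟩ ≡ ⟨ v , D n w ⟩
    U-adjoint n = adjoint (transpose (cover n))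

    U-norm : ∀ n v → ⟨ U (suc n) v , U (suc n) v ⟩ ≡ ⟨ D n v , D n v ⟩ + + r * ⟨ v , v ⟩
    U-norm n v = begin
      ⟨ U (suc n) v , U (suc n) v ⟩                ≡⟨ D-adjoint (suc n) (U (suc n) v) v ⟨
      ⟨ D (suc n) (U (suc n) v) , v ⟩              ≡⟨ ⟨⟩-congʳ (DU n v) v ⟩
      ⟨ (λ x → U n (D n v) x + + r * v x) , v ⟩    ≡⟨ ⟨⟩-linearˡ (+ r) (U n (D n v)) v v ⟩
      ⟨ U n (D n v) , v ⟩ + + r * ⟨ v , v ⟩        ≡⟨ cong (_+ + r * ⟨ v , v ⟩) (U-adjoint n (D n v) v) ⟩
      ⟨ D n v , D n v ⟩ + + r * ⟨ v , v ⟩          ∎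
      where open ≡-Reasoning

    -- U₀D₀ on ℚP₁ has eigenvalues 0 and r.
    D₀-norm : 0 ℕ.< r → ∀ v → ⟨ D 0 v , D 0 v ⟩ ≤ + r * ⟨ v , v ⟩
    D₀-norm (s≤s _) v = *-cancelˡ-≤-pos E (+ r * S) (+ r) (0≤i-j⇒j≤i (begin
      0ℤ                                             ≤⟨ 0≤⟨v,v⟩ w ⟩
      ⟨ w , w ⟩                                      ≡⟨ ⟨⟩-square (- + r) (U 0 (D 0 v)) v ⟩
      ⟨ U 0 (D 0 v) , U 0 (D 0 v) ⟩ + + 2 * (- + r) * ⟨ U 0 (D 0 v) , v ⟩ + (- + r) * (- + r) * S
        ≡⟨ cong₂ (λ a b → a + + 2 * (- + r) * b + (- + r) * (- + r) * S) UDUD (U-adjoint 0 (D 0 v) v) ⟩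
      + r * E + + 2 * (- + r) * E + (- + r) * (- + r) * S
        ≡⟨ simplify (+ r) E S ⟩
      + r * (+ r * S) - + r * E ∎))
      where
      open ≤-Reasoning
      E = ⟨ D 0 v , D 0 v ⟩
      S = ⟨ v , v ⟩
      w : Vector ℤ (p 1)
      w x = U 0 (D 0 v) x + (- + r) * v x
      UDUD : ⟨ U 0 (D 0 v) , U 0 (D 0 v) ⟩ ≡ + r * E
      UDUD = trans (sym (D-adjoint 0 (U 0 (D 0 v)) (D 0 v)))
        (trans (⟨⟩-congʳ (DU₀ (D 0 v)) (D 0 v)) (⟨⟩-*ˡ (+ r) (D 0 v) (D 0 v)))
      simplify : ∀ r e s → r * e + + 2 * (- r) * e + (- r) * (- r) * s ≡ r * (r * s) - r * e
      simplify = solve-∀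

    -- By `U-norm`, |Uv|² is at least r |v|².
    U-injective : 0 ℕ.< r → ∀ n v → (∀ x → U (suc n) v x ≡ 0ℤ) → ∀ x → v x ≡ 0ℤ
    U-injective (s≤s _) n v Uv≡0 = ⟨v,v⟩≡0⇒v≡0 v (≤-antisym (*-cancelˡ-≤-pos _ 0ℤ (+ r) (begin
      + r * ⟨ v , v ⟩                        ≡⟨ +-identityˡ _ ⟨
      0ℤ + + r * ⟨ v , v ⟩                   ≤⟨ +-monoˡ-≤ (+ r * ⟨ v , v ⟩) (0≤⟨v,v⟩ (D n v)) ⟩
      ⟨ D n v , D n v ⟩ + + r * ⟨ v , v ⟩    ≡⟨ U-norm n v ⟨
      ⟨ U (suc n) v , U (suc n) v ⟩          ≡⟨ ⟨⟩-zeroˡ Uv≡0 (U (suc n) v) ⟩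
      0ℤ                                     ≡⟨ *-zeroʳ (+ r) ⟨
      + r * 0ℤ                               ∎)) (0≤⟨v,v⟩ v))
      where open ≤-Reasoning

  -- The numerical argument in ranks 1 and 0.

  small-multiple : ∀ {a c} → 3 ℕ.≤ a → 0ℤ ≤ + a * c → + a * c ≤ + 2 → c ≡ 0ℤ
  small-multiple {a} {+ zero}   3≤a _ _ = refl
  small-multiple {a} {+ suc k}  3≤a _ ac≤2 = contradiction
    (drop‿+≤+ (subst (_≤ + 2) (sym (pos-* a (suc k))) ac≤2))
    (ℕ.<⇒≱ (ℕ.≤-trans 3≤a (ℕ.m≤m*n a (suc k))))
  small-multiple {suc a} { -[1+ k ]} 3≤a () _

  vanishing : ∀ {a} c N → 3 ℕ.≤ a → c ≢ 0ℤ → 0ℤ ≤ N →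
              0ℤ ≤ + a * (c * N) → + a * (c * N) ≤ + 2 * N → N ≡ 0ℤ
  vanishing c (+ zero) _ _ _ _ _ = refl
  vanishing {a} c N@(+ suc _) 3≤a c≢0 _ 0≤acN acN≤2N = contradiction
    (small-multiple 3≤a
      (*-cancelʳ-≤-pos 0ℤ (+ a * c) N (≤-trans 0≤acN (≤-reflexive (sym assoc))))
      (*-cancelʳ-≤-pos (+ a * c) (+ 2) N (≤-trans (≤-reflexive assoc) acN≤2N)))
    c≢0
    where
    assoc : + a * c * N ≡ + a * (c * N)
    assoc = *-assoc (+ a) c N

  -- S₁ and S₀ stand for the squared norms in ranks 1 and 0. From (a + r) E = S₀ ≥ 0 comes E ≥ 0,
  -- and (a + r) E = S₀ ≤ r S₁ ≤ (a + r) S₁ gives E ≤ S₁. Hence a c N = S₁ - E lies between 0 and S₁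
  -- ≤ 2 N, and `vanishing` applies.
  bottom-norms : ∀ {r a c N S₀ S₁ E} → 3 ℕ.≤ a → c ≢ 0ℤ → 0ℤ ≤ N → 0ℤ ≤ S₀ → 0ℤ ≤ S₁ →
              S₀ ≤ + r * S₁ → S₁ ≤ + 2 * N →
              S₀ ≡ + r * E + + a * E → S₁ ≡ E + + a * (c * N) → N ≡ 0ℤ
  bottom-norms {r} {a@(suc _)} {c} {N} {S₀} {S₁} {E} 3≤a c≢0 0≤N 0≤S₀ 0≤S₁ S₀≤rS₁ S₁≤2N S₀≡ S₁≡ =
    vanishing c N 3≤a c≢0 0≤N
      (≤-trans (i≤j⇒0≤j-i E≤S₁) (≤-reflexive S₁-E))
      (begin
        + a * (c * N)  ≡⟨ S₁-E ⟨
        S₁ - E         ≤⟨ +-monoʳ-≤ S₁ (neg-mono-≤ 0≤E) ⟩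
        S₁ + 0ℤ        ≡⟨ +-identityʳ S₁ ⟩
        S₁             ≤⟨ S₁≤2N ⟩
        + 2 * N        ∎)
    where
    open ≤-Reasoning
    b = + (a ℕ.+ r)
    S₁-E : S₁ - E ≡ + a * (c * N)
    S₁-E = trans (cong (_- E) S₁≡) (cancel E (+ a * (c * N)))
      where
      cancel : ∀ e x → (e + x) - e ≡ x
      cancel = solve-∀
    S₀≡bE : S₀ ≡ b * E
    S₀≡bE = trans S₀≡ (trans (+-comm (+ r * E) (+ a * E)) (sym (*-distribʳ-+ E (+ a) (+ r))))
    0≤E : 0ℤ ≤ E
    0≤E = *-cancelˡ-≤-pos 0ℤ E b (begin
      b * 0ℤ  ≡⟨ *-zeroʳ b ⟩
      0ℤ      ≤⟨ 0≤S₀ ⟩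
      S₀      ≡⟨ S₀≡bE ⟩
      b * E   ∎)
    E≤S₁ : E ≤ S₁
    E≤S₁ = *-cancelˡ-≤-pos E S₁ b (begin
      b * E              ≡⟨ S₀≡bE ⟨
      S₀                 ≤⟨ S₀≤rS₁ ⟩
      + r * S₁           ≡⟨ +-identityˡ (+ r * S₁) ⟨
      0ℤ + + r * S₁      ≡⟨ cong (_+ + r * S₁) (*-zeroʳ (+ a)) ⟨
      + a * 0ℤ + + r * S₁  ≤⟨ +-monoˡ-≤ (+ r * S₁) (*-monoˡ-≤-nonNeg (+ a) 0≤S₁) ⟩
      + a * S₁ + + r * S₁  ≡⟨ *-distribʳ-+ S₁ (+ a) (+ r) ⟨
      b * S₁             ∎)

  -- Descent along a family of threads.

  module RankGap {r : ℕ} (C : CoverMatrices r) (0<r : 0 ℕ.< r) where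
    open CoverMatrices C

    -- `Y k` lists the tips in rank k + 2. Several threads may start above the same atom, so `X`
    -- need not be injective; `X-bound` stands in for `incidence-norm` in rank 1.
    record ThreadFamily (s : ℕ) : Set where
      field
        Y       : ∀ k → Fin s → Fin (p (2 ℕ.+ k))
        Y▷Y     : ∀ k i → OnlyCovers (2 ℕ.+ k) (Y (suc k) i) (Y k i)
        Y₀-inj  : Injective _≡_ _≡_ (Y 0)
        X       : Fin s → Fin (p 1)
        Y₀▷X    : ∀ i → OnlyCovers 1 (Y 0 i) (X i)
        X-bound : ∀ t → ⟨ incidence X · t , incidence X · t ⟩ ≤ + 2 * ⟨ t , t ⟩

    module _ {s : ℕ} (F : ThreadFamily s) where
      open ThreadFamily F

      -- A tip determines its predecessor, so threads that differ in rank 2 never meet.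
      Y-injective : ∀ k → Injective _≡_ _≡_ (Y k)
      Y-injective zero = Y₀-inj
      Y-injective (suc k) {i} {j} eq = Y-injective k (OnlyCovers-unique (Y k i) (Y k j)
        (Y▷Y k i) (subst (λ y → OnlyCovers (2 ℕ.+ k) y (Y k j)) (sym eq) (Y▷Y k j)))

      tips : ∀ k → Vector ℤ s → Vector ℤ (p (2 ℕ.+ k))
      tips k t = incidence (Y k) · t

      tips-norm : ∀ k t → ⟨ tips k t , tips k t ⟩ ≡ ⟨ t , t ⟩
      tips-norm k = incidence-norm (Y-injective k)

      D-tips : ∀ k t → D (2 ℕ.+ k) (tips (suc k) t) ≗ tips k t
      D-tips k = D-incidence (Y (suc k)) (Y k) (Y▷Y k)

      -- If U v₀ = tips (k + j) t, then v = Dʲ v₀ satisfies this with q = j r and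
      -- c = cⱼ, since Dʲ⁺¹ U = U Dʲ⁺¹ + (j + 1) r Dʲ and D U = U D + r.
      Descended : ∀ k → ℕ → ℤ → Vector ℤ s → Set
      Descended k q c t = ∃ λ (v : Vector ℤ (p (suc k))) →
        (∀ x → D (suc k) (U (suc k) v) x + + q * v x ≡ D (suc k) (tips k t) x) ×
        ⟨ D (suc k) (tips k t) , v ⟩ ≡ c * ⟨ t , t ⟩

      UD : ∀ {k q c t} ((v , _) : Descended k q c t) →
           ∀ x → U k (D k v) x + + (q ℕ.+ r) * v x ≡ D (suc k) (tips k t) x
      UD {k} {q} (v , DU+q , _) x = trans (regroup (U k (D k v) x) (+ q) (+ r) (v x))
        (trans (cong (_+ + q * v x) (sym (DU k v x))) (DU+q x))
        where
        regroup : ∀ u q r v → u + (q + r) * v ≡ u + r * v + q * v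
        regroup = solve-∀

      -- Moving D across the pairing gives ⟨ w , U v ⟩ = |w|² for the combination w of tips, hence
      -- c₀ = 1.
      start : ∀ k v t → U (suc k) v ≗ tips k t → Descended k 0 1ℤ t
      start k v t Uv≗ = v , (λ x → trans (+-identityʳ _) (D-cong (suc k) Uv≗ x)) , (begin
        ⟨ D (suc k) (tips k t) , v ⟩  ≡⟨ D-adjoint (suc k) (tips k t) v ⟩
        ⟨ tips k t , U (suc k) v ⟩    ≡⟨ ⟨⟩-congˡ (tips k t) Uv≗ ⟩
        ⟨ tips k t , tips k t ⟩       ≡⟨ tips-norm k t ⟩
        ⟨ t , t ⟩                     ≡⟨ *-identityˡ ⟨ t , t ⟩ ⟨
        1ℤ * ⟨ t , t ⟩                ∎)
        where open ≡-Reasoning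

      -- With a = q + r, the vector UDv + a v equals `tips k t`. Applying D gives the operator
      -- equation for Dv. Pairing with `tips k t` gives ⟨ UDv , tips ⟩ = N - a c N, the recursion
      -- for cₖ.
      step : ∀ k q c t → Descended (suc k) q c t →
             Descended k (q ℕ.+ r) (1ℤ - + (q ℕ.+ r) * c) t
      step k q c t d@(v , _ , pairing) =
        D (suc k) v ,
        (λ x → trans (sym (D-linear (suc k) (+ a) (U (suc k) (D (suc k) v)) v x)) (D-cong (suc k) UD≗ x)) ,
        (begin
          ⟨ D (suc k) (tips k t) , D (suc k) v ⟩
            ≡⟨ D-adjoint (suc k) (tips k t) (D (suc k) v) ⟩
          ⟨ tips k t , w ⟩
            ≡⟨ ⟨⟩-comm (tips k t) w ⟩
          ⟨ w , tips k t ⟩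
            ≡⟨ isolate ⟨ w , tips k t ⟩ (+ a * ⟨ v , tips k t ⟩) ⟩
          ⟨ w , tips k t ⟩ + + a * ⟨ v , tips k t ⟩ - + a * ⟨ v , tips k t ⟩
            ≡⟨ cong (_- + a * ⟨ v , tips k t ⟩) (sym (⟨⟩-linearˡ (+ a) w v (tips k t))) ⟩
          ⟨ (λ x → w x + + a * v x) , tips k t ⟩ - + a * ⟨ v , tips k t ⟩
            ≡⟨ cong₂ (λ x y → x - + a * y) (trans (⟨⟩-congʳ UD≗ (tips k t)) (tips-norm k t)) ⟨v,tips⟩ ⟩
          ⟨ t , t ⟩ - + a * (c * ⟨ t , t ⟩)
            ≡⟨ factor (+ a) c ⟨ t , t ⟩ ⟩
          (1ℤ - + a * c) * ⟨ t , t ⟩ ∎)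
        where
        open ≡-Reasoning
        a = q ℕ.+ r
        w = U (suc k) (D (suc k) v)
        UD≗ : ∀ x → w x + + a * v x ≡ tips k t x
        UD≗ x = trans (UD {q = q} {c = c} {t = t} d x) (D-tips k t x)
        ⟨v,tips⟩ : ⟨ v , tips k t ⟩ ≡ c * ⟨ t , t ⟩
        ⟨v,tips⟩ = trans (⟨⟩-comm v (tips k t))
          (trans (⟨⟩-congʳ (λ x → sym (D-tips k t x)) v) pairing)
        isolate : ∀ x y → x ≡ x + y - y
        isolate = solve-∀
        factor : ∀ a c n → n - a * (c * n) ≡ (1ℤ - a * c) * n
        factor = solve-∀

      bottom : ∀ q c t → 3 ℕ.≤ q ℕ.+ r → c ≢ 0ℤ → Descended 0 q c t → ⟨ t , t ⟩ ≡ 0ℤ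
      bottom q c t 3≤a c≢0 d@(v , _ , pairing) =
        bottom-norms {r = r} {a = a} {E = E} 3≤a c≢0 (0≤⟨v,v⟩ t) (0≤⟨v,v⟩ (D 0 w)) (0≤⟨v,v⟩ w)
          (D₀-norm 0<r w) w≤2t S₀≡ S₁≡
        where
        a = q ℕ.+ r
        w = D 1 (tips 0 t)
        E = ⟨ D 0 v , D 0 w ⟩
        UD≗ : ∀ x → U 0 (D 0 v) x + + a * v x ≡ w x
        UD≗ = UD {q = q} {c = c} {t = t} d
        w≗X : w ≗ incidence X · t
        w≗X = D-incidence (Y 0) X Y₀▷X t
        w≤2t : ⟨ w , w ⟩ ≤ + 2 * ⟨ t , t ⟩
        w≤2t = subst (_≤ + 2 * ⟨ t , t ⟩)
          (sym (trans (⟨⟩-congˡ w w≗X) (⟨⟩-congʳ w≗X (incidence X · t)))) (X-bound t)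
        -- D is applied to UDv + a v = w; since DU = r on rank 0, D w is (r + a) D v.
        Dw≗ : ∀ x → + r * D 0 v x + + a * D 0 v x ≡ D 0 w x
        Dw≗ x = trans (cong (_+ + a * D 0 v x) (sym (DU₀ (D 0 v) x)))
          (trans (sym (D-linear 0 (+ a) (U 0 (D 0 v)) v x)) (D-cong 0 UD≗ x))
        S₀≡ : ⟨ D 0 w , D 0 w ⟩ ≡ + r * E + + a * E
        S₀≡ = trans (⟨⟩-congʳ (λ x → sym (Dw≗ x)) (D 0 w))
          (trans (⟨⟩-linearˡ (+ a) (λ x → + r * D 0 v x) (D 0 v) (D 0 w))
                 (cong (_+ + a * E) (⟨⟩-*ˡ (+ r) (D 0 v) (D 0 w))))
        S₁≡ : ⟨ w , w ⟩ ≡ E + + a * (c * ⟨ t , t ⟩)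
        S₁≡ = trans (⟨⟩-congʳ (λ x → sym (UD≗ x)) w)
          (trans (⟨⟩-linearˡ (+ a) (U 0 (D 0 v)) v w)
                 (cong₂ (λ x y → x + + a * y) (U-adjoint 0 (D 0 v) w) (trans (⟨⟩-comm v w) pairing)))

      -- Once the multiplier a = q + r is at least 3, the coefficient stays non-zero: 1 - a c = 0
      -- would mean a c = 1. Any steps with a smaller multiplier are carried out explicitly in
      -- `vanish₁` and `vanish₂`.
      descent : ∀ k q c t → 3 ℕ.≤ q ℕ.+ r → c ≢ 0ℤ → Descended k q c t → ⟨ t , t ⟩ ≡ 0ℤ
      descent zero    q c t 3≤a c≢0 d = bottom q c t 3≤a c≢0 d
      descent (suc k) q c t 3≤a c≢0 d =
        descent k a (1ℤ - + a * c) t (ℕ.≤-trans 3≤a (ℕ.m≤m+n a r)) c′≢0 (step k q c t d)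
        where
        a = q ℕ.+ r
        c′≢0 : 1ℤ - + a * c ≢ 0ℤ
        c′≢0 1-ac≡0 = c≢0 (small-multiple 3≤a
          (subst (0ℤ ≤_) 1≡ac (+≤+ z≤n))
          (subst (_≤ + 2) 1≡ac (+≤+ (s≤s z≤n))))
          where
          1≡ac : 1ℤ ≡ + a * c
          1≡ac = i-j≡0⇒i≡j 1ℤ (+ a * c) 1-ac≡0

      -- The columns of `A` are those of U followed by the negated tips, so a kernel vector is a
      -- pair v, t with U v = `tips k t`. Then t vanishes by hypothesis, and v by injectivity of U;
      -- so there are at most as many columns as rows.
      rank-bound : ∀ k → (∀ t → Descended k 0 1ℤ t → ⟨ t , t ⟩ ≡ 0ℤ) →
                   p (suc k) ℕ.+ s ℕ.≤ p (2 ℕ.+ k)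
      rank-bound k vanish = trivial-kernel⇒≤ A trivial
        where
        B : Matrix (p (2 ℕ.+ k)) s
        B z i = - incidence (Y k) z i
        A : Matrix (p (2 ℕ.+ k)) (p (suc k) ℕ.+ s)
        A z = transpose (cover (suc k)) z ++ B z

        B· : ∀ t z → (B · t) z ≡ - tips k t z
        B· t z = trans (sum-cong-≗ λ i → negate (t i) (incidence (Y k) z i))
          (trans (⟨⟩-*ˡ -1ℤ t (incidence (Y k) z)) (-1*i≡-i (tips k t z)))
          where
          negate : ∀ t y → t * - y ≡ -1ℤ * t * y
          negate = solve-∀

        trivial : ∀ x → (∀ z → (A · x) z ≡ 0ℤ) → ∀ j → x j ≡ 0ℤ
        trivial x Ax≡0 j = subst (λ l → x l ≡ 0ℤ) (join-splitAt (p (suc k)) s j)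
          (x≡0 (splitAt (p (suc k)) j))
          where
          v = take (p (suc k)) x
          t = drop (p (suc k)) x
          Uv≗ : U (suc k) v ≗ tips k t
          Uv≗ z = i-j≡0⇒i≡j (U (suc k) v z) (tips k t z)
            (trans (trans (cong (λ b → U (suc k) v z + b) (sym (B· t z)))
                          (sym (⟨⟩-++ (p (suc k)) x (λ w → cover (suc k) w z) (B z))))
                   (Ax≡0 z))
          t≡0 : ∀ i → t i ≡ 0ℤ
          t≡0 = ⟨v,v⟩≡0⇒v≡0 t (vanish t (start k v t Uv≗))
          Uv≡0 : ∀ z → U (suc k) v z ≡ 0ℤ
          Uv≡0 z = trans (Uv≗ z) (⟨⟩-zeroˡ t≡0 (incidence (Y k) z))
          x≡0 : ∀ l → x (join (p (suc k)) s l) ≡ 0ℤ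
          x≡0 (inj₁ i) = U-injective 0<r k v Uv≡0 i
          x≡0 (inj₂ i) = t≡0 i

    -- The 2r threads above the atoms, and the three cases.

    open Thread

    abstract
      atoms : ∃ λ (a : Fin r → Fin (p 1)) → Injective _≡_ _≡_ a × ∀ i → OnlyCovers 0 (a i) origin
      atoms = children 0 origin r (≤-reflexive (sym (surplus₀ origin)))

    atom : Fin r → Fin (p 1)
    atom = proj₁ atoms

    atom-injective : Injective _≡_ _≡_ atom
    atom-injective = proj₁ (proj₂ atoms)

    atom▷origin : ∀ i → OnlyCovers 0 (atom i) origin
    atom▷origin = proj₂ (proj₂ atoms)

    abstract
      -- The surplus is 2 rather than 1 because `origin`, the element below the atom, has only r
      -- upper covers instead of 1 + r.
      twins : ∀ i → ∃ λ (g : Fin 2 → Fin (p 2)) → Injective _≡_ _≡_ g × ∀ b → OnlyCovers 1 (g b) (atom i)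
      twins i = children 1 (atom i) 2 (≤-reflexive (sym (begin
        surplus 1 (atom i)                   ≡⟨ surplus₊ origin (atom▷origin i) ⟩
        + 2 + + r + -1ℤ * ups 0 origin       ≡⟨ cong (λ u → + 2 + + r + -1ℤ * u) (ups₀ origin) ⟩
        + 2 + + r + -1ℤ * + r                ≡⟨ simplify (+ r) ⟩
        + 2                                  ∎)))
        where
        open ≡-Reasoning
        simplify : ∀ r → + 2 + r + -1ℤ * r ≡ + 2
        simplify = solve-∀

    twin : Fin 2 → Fin r → Thread 1
    twin b i = record
      { top    = proj₁ (twins i) b
      ; below  = atom i
      ; covers = proj₂ (proj₂ (twins i)) b
      ; ups-≤  = ≤-reflexive (ups₊ origin (atom▷origin i))
      }

    twin-atom : ∀ {b b′ i j} → top (twin b i) ≡ top (twin b′ j) → i ≡ j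
    twin-atom {b} {b′} {i} {j} eq = atom-injective (OnlyCovers-unique (atom i) (atom j)
      (covers (twin b i)) (subst (λ z → OnlyCovers 1 z (atom j)) (sym eq) (covers (twin b′ j))))

    twins-distinct : ∀ i j → top (twin zero i) ≢ top (twin (suc zero) j)
    twins-distinct i j eq = distinct (twin-atom {zero} {suc zero} {i} {j} eq) eq
      where
      distinct : ∀ {i j} → i ≡ j → top (twin zero i) ≢ top (twin (suc zero) j)
      distinct {i} refl eq = Fin.0≢1+n (proj₁ (proj₂ (twins i)) eq)

    -- All first twins precede all second twins, so that each half of a coefficient vector sits on
    -- the injective map `atom`.
    threads : ∀ k → Fin (r ℕ.+ r) → Thread (suc k)
    threads zero    = twin zero ++ twin (suc zero)
    threads (suc k) = extension ∘ threads k

    threads-atom : ∀ t → let X = incidence (below ∘ threads 0) in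
                   X · t ≗ λ z → (incidence atom · take r t) z + (incidence atom · drop r t) z
    threads-atom t z = trans (sum-↑ r (λ i → t i * δ (below (threads 0 i)) z)) (cong₂ _+_
      (⟨⟩-congˡ (take r t) λ i → cong (λ h → δ (below h) z) (lookup-++ˡ (twin zero) (twin (suc zero)) i))
      (⟨⟩-congˡ (drop r t) λ i → cong (λ h → δ (below h) z) (lookup-++ʳ (twin zero) (twin (suc zero)) i)))

    -- The coefficients of two twins add up at their common atom. Each half of `t` keeps its norm,
    -- and adding the two halves costs the factor 2 of `norm-+-≤`.
    threads-bound : ∀ t → let X = incidence (below ∘ threads 0) in
                    ⟨ X · t , X · t ⟩ ≤ + 2 * ⟨ t , t ⟩
    threads-bound t = ≤-trans (norm-+-≤ u v (X · t) (threads-atom t))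
      (≤-reflexive (cong (λ s → + 2 * s) norms))
      where
      X = incidence (below ∘ threads 0)
      u = incidence atom · take r t
      v = incidence atom · drop r t
      norms : ⟨ u , u ⟩ + ⟨ v , v ⟩ ≡ ⟨ t , t ⟩
      norms = trans
        (cong₂ _+_ (incidence-norm atom-injective (take r t)) (incidence-norm atom-injective (drop r t)))
        (sym (⟨⟩-take-drop r t t))

    threadFamily : ThreadFamily (r ℕ.+ r)
    threadFamily = record
      { Y       = λ k → top ∘ threads k
      ; Y▷Y     = λ k i → covers (threads (suc k) i)
      ; Y₀-inj  = ∘-++-injective top
                    (λ {i} {j} → twin-atom {zero} {zero} {i} {j})
                    (λ {i} {j} → twin-atom {suc zero} {suc zero} {i} {j})
                    twins-distinct
      ; X       = below ∘ threads 0
      ; Y₀▷X    = λ i → covers (threads 0 i)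
      ; X-bound = threads-bound
      }

    -- For r = 1 the coefficients begin c₀ = 1, c₁ = 0, c₂ = 1. Two steps are made by hand, with
    -- multipliers 1 and 2, and `descent` takes over at c₂ with multiplier 3.
    vanish₁ : r ≡ 1 → ∀ k t → Descended threadFamily (2 ℕ.+ k) 0 1ℤ t → ⟨ t , t ⟩ ≡ 0ℤ
    vanish₁ refl k t d = descent threadFamily k 2 1ℤ t (s≤s (s≤s (s≤s z≤n))) (λ ())
      (step threadFamily k 1 0ℤ t (step threadFamily (suc k) 0 1ℤ t d))

    -- For r = 2 one step with multiplier 2 leads to c₁ = -1, and the next multiplier is 4.
    vanish₂ : r ≡ 2 → ∀ k t → Descended threadFamily (1 ℕ.+ k) 0 1ℤ t → ⟨ t , t ⟩ ≡ 0ℤ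
    vanish₂ refl k t d = descent threadFamily k 2 -1ℤ t (s≤s (s≤s (s≤s z≤n))) (λ ())
      (step threadFamily k 0 1ℤ t d)

    vanish₃ : r ℕ.> 2 → ∀ k t → Descended threadFamily k 0 1ℤ t → ⟨ t , t ⟩ ≡ 0ℤ
    vanish₃ r>2 k t = descent threadFamily k 0 1ℤ t r>2 (λ ())

    rank-gap : ∀ n → (r ≡ 1 × n ℕ.≥ 4) ⊎ (r ≡ 2 × n ℕ.≥ 3) ⊎ (r ℕ.> 2 × n ℕ.≥ 2) →
               ∃ λ k → n ≡ 2 ℕ.+ k × p (suc k) ℕ.+ (r ℕ.+ r) ℕ.≤ p (2 ℕ.+ k)
    rank-gap _ (inj₁ (r≡1 , s≤s (s≤s (s≤s (s≤s (z≤n {k})))))) =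
      2 ℕ.+ k , refl , rank-bound threadFamily (2 ℕ.+ k) (vanish₁ r≡1 k)
    rank-gap _ (inj₂ (inj₁ (r≡2 , s≤s (s≤s (s≤s (z≤n {k})))))) =
      1 ℕ.+ k , refl , rank-bound threadFamily (1 ℕ.+ k) (vanish₂ r≡2 k)
    rank-gap _ (inj₂ (inj₂ (r>2 , s≤s (s≤s (z≤n {k}))))) =
      k , refl , rank-bound threadFamily k (vanish₃ r>2 k)

  -- Transfer of the commutation relation from ℚ to ℤ.

  toℚ : ℤ → ℚ
  toℚ z = z ℚ./ 1

  -- Division in ℚ normalises, so the arithmetic of `toℚ` is checked on unnormalised fractions. The
  -- 0 in `mkℚᵘ z 0` is the denominator minus one.
  toℚᵘ-toℚ : ∀ z → toℚᵘ (toℚ z) ℚᵘ.≃ mkℚᵘ z 0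
  toℚᵘ-toℚ z = ℚ.toℚᵘ-fromℚᵘ (mkℚᵘ z 0)

  toℚ-injective : ∀ {y z} → toℚ y ≡ toℚ z → y ≡ z
  toℚ-injective {y} {z} eq with ℚ.fromℚᵘ-injective {mkℚᵘ y 0} {mkℚᵘ z 0} eq
  ... | *≡* y*1≡z*1 = trans (sym (*-identityʳ y)) (trans y*1≡z*1 (*-identityʳ z))

  toℚ-+ : ∀ y z → toℚ (y + z) ≡ toℚ y ℚ.+ toℚ z
  toℚ-+ y z = ℚ.toℚᵘ-injective (begin
    toℚᵘ (toℚ (y + z))                ≈⟨ toℚᵘ-toℚ (y + z) ⟩
    mkℚᵘ (y + z) 0
      ≈⟨ *≡* (cong (_* 1ℤ) (cong₂ _+_ (sym (*-identityʳ y)) (sym (*-identityʳ z)))) ⟩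
    mkℚᵘ y 0 ℚᵘ.+ mkℚᵘ z 0            ≈⟨ ℚᵘ.+-cong (toℚᵘ-toℚ y) (toℚᵘ-toℚ z) ⟨
    toℚᵘ (toℚ y) ℚᵘ.+ toℚᵘ (toℚ z)    ≈⟨ ℚ.toℚᵘ-homo-+ (toℚ y) (toℚ z) ⟨
    toℚᵘ (toℚ y ℚ.+ toℚ z)            ∎)
    where open ℚᵘ.≃-Reasoning

  toℚ-* : ∀ y z → toℚ (y * z) ≡ toℚ y ℚ.* toℚ z
  toℚ-* y z = ℚ.toℚᵘ-injective (begin
    toℚᵘ (toℚ (y * z))                ≈⟨ toℚᵘ-toℚ (y * z) ⟩
    mkℚᵘ y 0 ℚᵘ.* mkℚᵘ z 0            ≈⟨ ℚᵘ.*-cong (toℚᵘ-toℚ y) (toℚᵘ-toℚ z) ⟨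
    toℚᵘ (toℚ y) ℚᵘ.* toℚᵘ (toℚ z)    ≈⟨ ℚ.toℚᵘ-homo-* (toℚ y) (toℚ z) ⟨
    toℚᵘ (toℚ y ℚ.* toℚ z)            ∎)
    where open ℚᵘ.≃-Reasoning

  toℚ-sum : (f : Vector ℤ n) → sumℚ (toℚ ∘ f) ≡ toℚ (sum f)
  toℚ-sum {zero}  f = refl
  toℚ-sum {suc n} f = trans (cong (λ s → toℚ (f zero) ℚ.+ s) (toℚ-sum (f ∘ suc)))
                            (sym (toℚ-+ (f zero) (sum (f ∘ suc))))

  ℚ-sub : ∀ {x y z} → x ℚ.- y ≡ z → x ≡ y ℚ.+ z
  ℚ-sub {x} {y} {z} x-y≡z = begin
    x                        ≡⟨ ℚ.+-identityʳ x ⟨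
    x ℚ.+ 0ℚ                 ≡⟨ cong (λ s → x ℚ.+ s) (ℚ.+-inverseˡ y) ⟨
    x ℚ.+ (ℚ.- y ℚ.+ y)      ≡⟨ ℚ.+-assoc x (ℚ.- y) y ⟨
    x ℚ.- y ℚ.+ y            ≡⟨ cong (ℚ._+ y) x-y≡z ⟩
    z ℚ.+ y                  ≡⟨ ℚ.+-comm z y ⟩
    y ℚ.+ z                  ∎
    where open ≡-Reasoning

  indicator : Bool → ℤ
  indicator b = if b then 1ℤ else 0ℤ

  indicator-0∨1 : ∀ b → indicator b ≡ 0ℤ ⊎ indicator b ≡ 1ℤ
  indicator-0∨1 false = inj₁ refl
  indicator-0∨1 true  = inj₂ refl

  toℚ-indicator : ∀ b → (if b then 1ℚ else 0ℚ) ≡ toℚ (indicator b)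
  toℚ-indicator false = refl
  toℚ-indicator true  = refl

  module _ {r c ℓ₁ ℓ₂} (P : DifferentialPoset r c ℓ₁ ℓ₂) where
    open DifferentialPoset P
      using (p; element; _⋖?_; extend; commutation; rank-finite; rank-minimal; 0̂; 0̂-minimal)
      renaming (U to Uℚ; D to Dℚ)

    cover : ∀ n → Matrix (p n) (p (suc n))
    cover n x z = indicator (does (element n x ⋖? element (suc n) z))

    -- The input is compared with `toℚ ∘ v` pointwise, so that the lemma can be applied in
    -- succession to composites such as DU.
    extend-toℚ : (A : Matrix m n) (b : Fin n → Vector ℚ m) → (∀ i j → b j i ≡ toℚ (A i j)) →
                 ∀ v {u} → u ≗ toℚ ∘ v → extend b u ≗ toℚ ∘ (A · v)
    extend-toℚ A b b≡A v u≗v i = trans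
      (sumℚ-cong λ j → trans (cong₂ ℚ._*_ (u≗v j) (b≡A i j)) (sym (toℚ-* (v j) (A i j))))
      (toℚ-sum λ j → v j * A i j)

    U-toℚ : ∀ n v {u} → u ≗ toℚ ∘ v → Uℚ n u ≗ toℚ ∘ (transpose (cover n) · v)
    U-toℚ n = extend-toℚ (transpose (cover n)) _ λ z x → toℚ-indicator _

    D-toℚ : ∀ n v {u} → u ≗ toℚ ∘ v → Dℚ (suc n) u ≗ toℚ ∘ (cover n · v)
    D-toℚ n = extend-toℚ (cover n) _ λ x z → toℚ-indicator _

    coverMatrices : CoverMatrices r
    coverMatrices = record
      { p      = p
      ; cover  = cover
      ; 0∨1    = λ n x z → indicator-0∨1 (does (element n x ⋖? element (suc n) z))
      ; origin = Finite.from (rank-finite 0) (0̂ , rank-minimal 0̂-minimal)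
      ; DU₀    = λ v x → toℚ-injective (begin
          toℚ ((cover 0 · transpose (cover 0) · v) x)  ≡⟨ DU-toℚ 0 v x ⟨
          -- The subtracted term is 0 because U₋₁ is the zero map.
          Dℚ 1 (Uℚ 0 (toℚ ∘ v)) x                      ≡⟨ ℚ-sub {y = 0ℚ} (commutation 0 (toℚ ∘ v) x) ⟩
          0ℚ ℚ.+ toℚ (+ r) ℚ.* toℚ (v x)               ≡⟨ ℚ.+-identityˡ _ ⟩
          toℚ (+ r) ℚ.* toℚ (v x)                      ≡⟨ toℚ-* (+ r) (v x) ⟨
          toℚ (+ r * v x)                              ∎)
      ; DU     = λ n v x → toℚ-injective (begin
          toℚ ((cover (suc n) · transpose (cover (suc n)) · v) x)
            ≡⟨ DU-toℚ (suc n) v x ⟨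
          Dℚ (2 ℕ.+ n) (Uℚ (suc n) (toℚ ∘ v)) x
            ≡⟨ ℚ-sub (commutation (suc n) (toℚ ∘ v) x) ⟩
          Uℚ n (Dℚ (suc n) (toℚ ∘ v)) x ℚ.+ toℚ (+ r) ℚ.* toℚ (v x)
            ≡⟨ cong₂ ℚ._+_ (U-toℚ n (cover n · v) (D-toℚ n v λ _ → refl) x) (sym (toℚ-* (+ r) (v x))) ⟩
          toℚ ((transpose (cover n) · cover n · v) x) ℚ.+ toℚ (+ r * v x)
            ≡⟨ toℚ-+ ((transpose (cover n) · cover n · v) x) (+ r * v x) ⟨
          toℚ ((transpose (cover n) · cover n · v) x + + r * v x) ∎)
      }
      where
      open ≡-Reasoning
      DU-toℚ : ∀ n v x → Dℚ (suc n) (Uℚ n (toℚ ∘ v)) x ≡ toℚ ((cover n · transpose (cover n) · v) x)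
      DU-toℚ n v = D-toℚ n (transpose (cover n) · v) (U-toℚ n v λ _ → refl)

  -- The bound on the rank gap as an integer.

  ≤-difference : ∀ a b r → a ℕ.+ (r ℕ.+ r) ℕ.≤ b → + (2 ℕ.* r) ≤ + b - + a
  ≤-difference a b r a+2r≤b = begin
    + (2 ℕ.* r)     ≤⟨ +≤+ (ℕ.m+n≤o⇒m≤o∸n (2 ℕ.* r) (ℕ.≤-trans (ℕ.≤-reflexive 2r+a) a+2r≤b)) ⟩
    + (b ℕ.∸ a)     ≡⟨ ⊖-≥ (ℕ.≤-trans (ℕ.m≤m+n a (r ℕ.+ r)) a+2r≤b) ⟨
    b ⊖ a           ≡⟨ [+m]-[+n]≡m⊖n b a ⟨
    + b - + a       ∎
    where
    open ≤-Reasoning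
    2r+a : 2 ℕ.* r ℕ.+ a ≡ a ℕ.+ (r ℕ.+ r)
    2r+a = trans (ℕ.+-comm (2 ℕ.* r) a) (cong (λ s → a ℕ.+ (r ℕ.+ s)) (ℕ.+-identityʳ r))

  Δp-bound : ∀ {c ℓ₁ ℓ₂} r → 0 ℕ.< r → (P : DifferentialPoset r c ℓ₁ ℓ₂) → ∀ n →
             (r ≡ 1 × n ℕ.≥ 4) ⊎ (r ≡ 2 × n ℕ.≥ 3) ⊎ (r ℕ.> 2 × n ℕ.≥ 2) →
             + (2 ℕ.* r) ≤ DifferentialPoset.Δp P n
  Δp-bound r 0<r P n cases with RankGap.rank-gap (coverMatrices P) 0<r n cases
  ... | k , refl , bound = ≤-difference (p (suc k)) (p (2 ℕ.+ k)) r bound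
    where open DifferentialPoset P using (p)

open import Data.Integer using (+_) renaming (_≥_ to _≥ℤ_)
open import Data.Nat using (ℕ; _*_; _<_; _≥_; _>_)
open import Data.Product using (_×_)
open import Data.Sum using (_⊎_)
open import Relation.Binary.PropositionalEquality using (_≡_)

theorem1p4 : ∀ {c ℓ₁ ℓ₂} (r : ℕ) → 0 < r → (P : DifferentialPoset r c ℓ₁ ℓ₂) → ∀ n →
    (r ≡ 1 × n ≥ 4) ⊎ (r ≡ 2 × n ≥ 3) ⊎ (r > 2 × n ≥ 2) →
    DifferentialPoset.Δp P n ≥ℤ + (2 * r)
theorem1p4 = IntegerMatrices.Δp-bound
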